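{- Let $q\geq 2$ and let $\gamma$ be an integer. There exists a completely regular code $C$ in $H(3,q)$ with covering radius $1$, eigenvalue $\lambda_2(3,q)=q-3$, parameter $\gamma$ and $\gamma\leq\beta$ if and only if one of the following holds: (1) $\gamma$ is even and $2\leq \gamma\leq q$; (2) $q$ is even and $\frac{q}{2}\leq \gamma\leq q$; (3) $q$ is even, $\gamma$ is odd, $\gamma<\frac{q}{2}$, and Condition 1 holds for $q$ and $\gamma$.
   Context: Let $\mathcal{A}$ be a set of size $q\geq 2$. The Hamming graph $H(n,q)$ has vertex set $\mathcal{A}^n$, two tuples being adjacent iff they differ in exactly one position; it is $n(q-1)$-regular and its eigenvalues are $\lambda_i(n,q)=n(q-1)-qi$, $i=0,\dots,n$. For a $k$-regular graph $\Gamma$, a set $C$ of vertices is a completely regular code with covering radius $1$ if $C$ is a nonempty proper subset of the vertex set and there are integers $\beta$ and $\gamma\geq 1$ such that every vertex of $C$ has exactly $\beta$ neighbours outside $C$ and every vertex outside $C$ has exactly $\gamma$ neighbours in $C$. Its intersection matrix is $\begin{pmatrix}k-\beta&\beta\\ \gamma&k-\gamma\end{pmatrix}$, whose eigenvalues are $k$ and $k-(\beta+\gamma)$; "the code has eigenvalue $\lambda$" (for $\lambda\neq k$) means $k-(\beta+\gamma)=\lambda$. Thus eigenvalue $\lambda_2(3,q)$ means $\beta+\gamma=2q$. Condition 1 (for $q$ and $\gamma$): there exist integers $r,s,t$ with $0<r,s,t<q$ and integers $a,b,c$ with $0<c\leq\min\{q-s,q-t\}$, $0<b\leq \min\{t,q-r\}$,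 $0<a\leq\min\{r,s\}$ such that $cr=a(q-t)$, $b(q-s)=c(q-r)$, $at=bs$, and $\gamma=a+b+c$. -}

module Defs where

open import Data.Nat using (ℕ; zero; suc; _+_; _*_; _∸_; _≤_; _<_)
open import Data.Nat.Properties using (_≟_)
open import Data.Fin using (Fin)
import Data.Fin.Properties as FinP
open import Data.Vec using (Vec; []; _∷_)
open import Data.List using (List; []; _∷_; length; filter; map; concatMap; allFin)
open import Data.Bool using (Bool; true; false)
import Data.Bool.Properties as BoolP
open import Data.Product using (Σ; ∃; _×_; _,_)
open import Data.Integer as ℤ using (ℤ; +_)
open import Relation.Binary.PropositionalEquality using (_≡_)
open import Relation.Nullary using (Dec; yes; no)
open import Relation.Nullary.Decidable using (¬?)

Vertex : ℕ → ℕ → Set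
Vertex n q = Vec (Fin q) n

dist : ∀ {n q} → Vertex n q → Vertex n q → ℕ
dist [] [] = 0
dist (x ∷ u) (y ∷ v) with x FinP.≟ y
... | yes _ = dist u v
... | no  _ = suc (dist u v)

Adjacent : ∀ {n q} → Vertex n q → Vertex n q → Set
Adjacent u v = dist u v ≡ 1

adjacent? : ∀ {n q} (u v : Vertex n q) → Dec (Adjacent u v)
adjacent? u v = dist u v ≟ 1

allVertices : (n q : ℕ) → List (Vertex n q)
allVertices zero    q = [] ∷ []
allVertices (suc n) q =
  concatMap (λ x → map (x ∷_) (allVertices n q)) (allFin q)

degree : ℕ → ℕ → ℕ
degree n q = n * (q ∸ 1)

hammingEigenvalue : (n q i : ℕ) → ℤ
hammingEigenvalue n q i = + (n * (q ∸ 1)) ℤ.- + (q * i)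

Code : ℕ → ℕ → Set
Code n q = Vertex n q → Bool

outsideNeighbours : ∀ {n q} → Code n q → Vertex n q → ℕ
outsideNeighbours {n} {q} C v =
  length (filter (λ w → adjacent? v w) (filter (λ w → C w Data.Bool.≟ false) (allVertices n q)))
  where import Data.Bool

insideNeighbours : ∀ {n q} → Code n q → Vertex n q → ℕ
insideNeighbours {n} {q} C v =
  length (filter (λ w → adjacent? v w) (filter (λ w → C w Data.Bool.≟ true) (allVertices n q)))
  where import Data.Bool

IsCRC1 : ∀ {n q} → Code n q → (β γ : ℕ) → Set
IsCRC1 {n} {q} C β γ =
  (∃ λ v → C v ≡ true) ×
  (∃ λ v → C v ≡ false) ×
  (1 ≤ γ) ×
  (∀ v → C v ≡ true  → outsideNeighbours C v ≡ β) ×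
  (∀ v → C v ≡ false → insideNeighbours  C v ≡ γ)

-- The (non-principal) eigenvalue k - (β + γ) of the intersection matrix.
codeEigenvalue : (n q β γ : ℕ) → ℤ
codeEigenvalue n q β γ = + degree n q ℤ.- + (β + γ)

Condition1 : ℕ → ℕ → Set
Condition1 q γ =
  Σ ℕ λ r → Σ ℕ λ s → Σ ℕ λ t → Σ ℕ λ a → Σ ℕ λ b → Σ ℕ λ c →
    (0 < r) × (r < q) × (0 < s) × (s < q) × (0 < t) × (t < q) ×
    (0 < c) × (c ≤ q ∸ s) × (c ≤ q ∸ t) ×
    (0 < b) × (b ≤ t) × (b ≤ q ∸ r) ×
    (0 < a) × (a ≤ r) × (a ≤ s) ×
    (c * r ≡ a * (q ∸ t)) × (b * (q ∸ s) ≡ c * (q ∸ r)) × (a * t ≡ b * s) ×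
    (γ ≡ a + b + c)

-- The lines through a vertex v cover v three times and each neighbour once. So C, with indicator
-- function f, is completely regular with β + γ = 2q iff the three line sums at every vertex add up
-- to q f + γ. Summing this over a line shows that every plane sum is qγ/2, so qγ is even.
--
-- If 2γ < q, a line is either contained in C or has at most γ codewords, and every codeword lies on
-- exactly one full line. Hence f(x,y,z) = P(y,z) + Q(z,x) + R(x,y), where P, Q, R are the indicators
-- of the full lines, and comparing line sums gives degrees
--   deg_Q x + deg_R x = a,  deg_R y + deg_P y = b,  deg_P z + deg_Q z = c,  a + b + c = γ,
-- in which one term of each sum vanishes because the lines are disjoint. So P, Q, R are biregular
-- bipartite graphs; counting their edges in two ways gives Condition 1, unless one of them is empty,
-- and then one of a, b, c is the sum of the other two and γ is even.
--
-- Conversely, any such P, Q, R give a code: for even γ take P biregular of degree γ/2 and Q, R empty;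
-- for q = 2p and p ≤ γ < q take the complement of the code with degrees p, q - γ, p.
module Submission where

open import Defs
open import Algebra.Properties.AbelianGroup using (∙-cancelˡ)
open import Data.Bool using (Bool; true; false; not)
import Data.Bool as Bool
open import Data.Fin using (Fin; zero; suc; toℕ; splitAt)
import Data.Fin.Properties as Fin
import Data.Integer as ℤ
import Data.Integer.Properties as ℤ
open import Data.List as List using (List; length; filter; concatMap; tabulate)
open import Data.List.Properties using (map-++; map-∘)
open import Data.Nat using (ℕ; zero; suc; _+_; _*_; _∸_; _≤_; _<_; _/_; z≤n; s≤s; NonZero; >-nonZero; >-nonZero⁻¹)
open import Data.Nat.Divisibility using (_∣_; _∣?_; divides; ∣⇒≤; ∣-refl; n∣m*n)
open import Data.Nat.DivMod using (m<n⇒m/n≡0; m/n≤m; /-monoˡ-≤; n/n≡1; m*n/n≡m; +-distrib-/-∣ˡ; +-distrib-/-∣ʳ)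
open import Data.Nat.ListAction using () renaming (sum to listSum)
open import Data.Nat.ListAction.Properties using (sum-++)
open import Data.Nat.Primality using (euclidsLemma; prime[2])
open import Data.Nat.Properties
open import Data.Nat.Tactic.RingSolver using (solve-∀)
open import Data.Product using (Σ; ∃; _×_; _,_; proj₁; proj₂)
open import Data.Sum as Sum using (_⊎_; inj₁; inj₂; [_,_]′)
open import Data.Vec using ([]; _∷_)
open import Algebra.Properties.Semiring.Sum +-*-semiring using (sum; sum-cong-≗; ∑-distrib-+; ∑-comm; *-distribˡ-sum)
open import Function using (_∘_; _$_)
open import Function.Bundles using (_⇔_; mk⇔; module Equivalence)
open import Relation.Binary.Definitions using (tri<; tri≈; tri>)
open import Relation.Binary.PropositionalEquality using (_≡_; refl; sym; trans; cong; cong₂; subst; module ≡-Reasoning)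
open import Relation.Nullary using (¬_; Dec; yes; no; does; contradiction)
open import Relation.Nullary.Decidable using (dec-true; dec-false)

open ≡-Reasoning

-- Finite sums and indicators

double : ∀ n → n + n ≡ n * 2
double = solve-∀

ι : Bool → ℕ
ι true  = 1
ι false = 0

ι≤1 : ∀ b → ι b ≤ 1
ι≤1 true  = ≤-refl
ι≤1 false = z≤n

ι-not : ∀ b → ι b + ι (not b) ≡ 1
ι-not true  = refl
ι-not false = refl

sum-const : ∀ n c → sum {n} (λ _ → c) ≡ n * c
sum-const zero    c = refl
sum-const (suc n) c = cong (c +_) (sum-const n c)

sum-zero : ∀ n → sum {n} (λ _ → 0) ≡ 0
sum-zero n = trans (sum-const n 0) (*-zeroʳ n)

sum-mono : ∀ {n} {f g : Fin n → ℕ} → (∀ i → f i ≤ g i) → sum f ≤ sum g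
sum-mono {zero}  f≤g = z≤n
sum-mono {suc n} f≤g = +-mono-≤ (f≤g zero) (sum-mono (f≤g ∘ suc))

term≤sum : ∀ {n} (f : Fin n → ℕ) i → f i ≤ sum f
term≤sum f zero    = m≤m+n (f zero) _
term≤sum f (suc i) = ≤-trans (term≤sum (f ∘ suc) i) (m≤n+m _ (f zero))

sum-positive : ∀ {n} (f : Fin n → ℕ) → 0 < sum f → ∃ λ i → 0 < f i
sum-positive {suc n} f 0<Σ with f zero in eq
... | suc k = zero , subst (0 <_) (sym eq) (s≤s z≤n)
... | zero with sum-positive (f ∘ suc) 0<Σ
...   | i , 0<fi = suc i , 0<fi

δ : ∀ {n} → Fin n → Fin n → ℕ
δ i j = ι (does (i Fin.≟ j))

sum-δ : ∀ {n} (i : Fin n) (f : Fin n → ℕ) → sum (λ j → δ i j * f j) ≡ f i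
sum-δ {suc n} zero f = begin
  f zero + 0 + sum {n} (λ _ → 0)  ≡⟨ cong (f zero + 0 +_) (sum-zero n) ⟩
  f zero + 0 + 0              ≡⟨ trans (+-identityʳ _) (+-identityʳ _) ⟩
  f zero                      ∎
sum-δ (suc i) f = sum-δ i (f ∘ suc)

-- Neighbour counts as line sums

Σ³ : ∀ {q} → (Fin q → Fin q → Fin q → ℕ) → ℕ
Σ³ g = sum λ x → sum λ y → sum λ z → g x y z

Σ³-cong : ∀ {q} {g h : Fin q → Fin q → Fin q → ℕ} → (∀ x y z → g x y z ≡ h x y z) → Σ³ g ≡ Σ³ h
Σ³-cong e = sum-cong-≗ λ x → sum-cong-≗ λ y → sum-cong-≗ λ z → e x y z

Σ³-+ : ∀ {q} (g h : Fin q → Fin q → Fin q → ℕ) → Σ³ (λ x y z → g x y z + h x y z) ≡ Σ³ g + Σ³ h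
Σ³-+ g h = begin
  Σ³ (λ x y z → g x y z + h x y z)
    ≡⟨ sum-cong-≗ (λ x → trans (sum-cong-≗ λ y → ∑-distrib-+ (g x y) (h x y))
                               (∑-distrib-+ (λ y → sum (g x y)) _)) ⟩
  sum (λ x → sum (λ y → sum (g x y)) + sum (λ y → sum (h x y)))
    ≡⟨ ∑-distrib-+ (λ x → sum λ y → sum (g x y)) _ ⟩
  Σ³ g + Σ³ h ∎

Σ³-δᶻ : ∀ {q} z (g : Fin q → Fin q → Fin q → ℕ) →
  Σ³ (λ x′ y′ z′ → δ z z′ * g x′ y′ z′) ≡ sum λ x′ → sum λ y′ → g x′ y′ z
Σ³-δᶻ z g = sum-cong-≗ λ x′ → sum-cong-≗ λ y′ → sum-δ z (g x′ y′)

Σ³-δʸ : ∀ {q} y (g : Fin q → Fin q → Fin q → ℕ) →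
  Σ³ (λ x′ y′ z′ → δ y y′ * g x′ y′ z′) ≡ sum λ x′ → sum λ z′ → g x′ y z′
Σ³-δʸ y g = sum-cong-≗ λ x′ →
  trans (sum-cong-≗ λ y′ → sym (*-distribˡ-sum (δ y y′) (g x′ y′))) (sum-δ y λ y′ → sum (g x′ y′))

Σ²-δ : ∀ {q} x (g : Fin q → Fin q → ℕ) →
  (sum λ x′ → sum λ y′ → δ x x′ * g x′ y′) ≡ sum (g x)
Σ²-δ x g = trans (sum-cong-≗ λ x′ → sym (*-distribˡ-sum (δ x x′) (g x′))) (sum-δ x λ x′ → sum (g x′))

lineSums : ∀ {q} → (Fin q → Fin q → Fin q → ℕ) → Fin q → Fin q → Fin q → ℕ
lineSums g x y z = sum (λ i → g i y z) + sum (λ i → g x i z) + sum (λ i → g x y i)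

adj : ∀ {n q} → Vertex n q → Vertex n q → ℕ
adj v w = ι (does (adjacent? v w))

dist-∷ : ∀ {n q} (x y : Fin q) (u v : Vertex n q) →
  dist (x ∷ u) (y ∷ v) ≡ ι (not (does (x Fin.≟ y))) + dist u v
dist-∷ x y u v with x Fin.≟ y
... | yes _ = refl
... | no  _ = refl

-- Each product of two `δ`s is the indicator of a line through the vertex. A neighbour lies on one
-- of these three lines and the vertex itself on all three, hence the correction term.
adj-δ : ∀ {q} (x y z x′ y′ z′ : Fin q) →
  adj (x ∷ y ∷ z ∷ []) (x′ ∷ y′ ∷ z′ ∷ []) + 3 * (δ z z′ * (δ y y′ * δ x x′))
  ≡ δ z z′ * δ y y′ + δ z z′ * δ x x′ + δ y y′ * δ x x′
adj-δ x y z x′ y′ z′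
  rewrite dist-∷ x x′ (y ∷ z ∷ []) (y′ ∷ z′ ∷ []) | dist-∷ y y′ (z ∷ []) (z′ ∷ []) | dist-∷ z z′ [] []
  with does (x Fin.≟ x′) | does (y Fin.≟ y′) | does (z Fin.≟ z′)
... | true  | true  | true  = refl
... | true  | true  | false = refl
... | true  | false | true  = refl
... | true  | false | false = refl
... | false | true  | true  = refl
... | false | true  | false = refl
... | false | false | true  = refl
... | false | false | false = refl

neighbour-sum : ∀ {q} (g : Fin q → Fin q → Fin q → ℕ) x y z →
  Σ³ (λ x′ y′ z′ → adj (x ∷ y ∷ z ∷ []) (x′ ∷ y′ ∷ z′ ∷ []) * g x′ y′ z′) + 3 * g x y z
  ≡ lineSums g x y z
neighbour-sum g x y z = begin
  Σ³ (λ x′ y′ z′ → α x′ y′ z′ * g x′ y′ z′) + 3 * g x y z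
    -- The correction becomes a triple sum concentrated at the vertex, so that `adj-δ` applies
    -- termwise. The factor `δ z z′` stands outermost because the sum over `z′` is the innermost
    -- one.
    ≡⟨ cong (Σ³ (λ x′ y′ z′ → α x′ y′ z′ * g x′ y′ z′) +_) (sym point) ⟩
  Σ³ (λ x′ y′ z′ → α x′ y′ z′ * g x′ y′ z′) + Σ³ (λ x′ y′ z′ → δ z z′ * (δ y y′ * (δ x x′ * (3 * g x′ y′ z′))))
    ≡⟨ sym (Σ³-+ (λ x′ y′ z′ → α x′ y′ z′ * g x′ y′ z′) _) ⟩
  Σ³ (λ x′ y′ z′ → α x′ y′ z′ * g x′ y′ z′ + δ z z′ * (δ y y′ * (δ x x′ * (3 * g x′ y′ z′))))
    ≡⟨ Σ³-cong (λ x′ y′ z′ → pointwise (α x′ y′ z′) (δ x x′) (δ y y′) (δ z z′) (g x′ y′ z′) (adj-δ x y z x′ y′ z′)) ⟩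
  Σ³ (λ x′ y′ z′ → δ z z′ * (δ y y′ * g x′ y′ z′) + δ z z′ * (δ x x′ * g x′ y′ z′) + δ y y′ * (δ x x′ * g x′ y′ z′))
    ≡⟨ Σ³-+ (λ x′ y′ z′ → δ z z′ * (δ y y′ * g x′ y′ z′) + δ z z′ * (δ x x′ * g x′ y′ z′)) _ ⟩
  Σ³ (λ x′ y′ z′ → δ z z′ * (δ y y′ * g x′ y′ z′) + δ z z′ * (δ x x′ * g x′ y′ z′))
    + Σ³ (λ x′ y′ z′ → δ y y′ * (δ x x′ * g x′ y′ z′))
    ≡⟨ cong₂ _+_ (Σ³-+ (λ x′ y′ z′ → δ z z′ * (δ y y′ * g x′ y′ z′)) _) refl ⟩
  Σ³ (λ x′ y′ z′ → δ z z′ * (δ y y′ * g x′ y′ z′)) + Σ³ (λ x′ y′ z′ → δ z z′ * (δ x x′ * g x′ y′ z′))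
    + Σ³ (λ x′ y′ z′ → δ y y′ * (δ x x′ * g x′ y′ z′))
    ≡⟨ cong₂ _+_ (cong₂ _+_
         (trans (Σ³-δᶻ z (λ x′ y′ z′ → δ y y′ * g x′ y′ z′)) (sum-cong-≗ λ x′ → sum-δ y λ y′ → g x′ y′ z))
         (trans (Σ³-δᶻ z (λ x′ y′ z′ → δ x x′ * g x′ y′ z′)) (Σ²-δ x λ x′ y′ → g x′ y′ z)))
         (trans (Σ³-δʸ y (λ x′ y′ z′ → δ x x′ * g x′ y′ z′)) (Σ²-δ x λ x′ z′ → g x′ y z′)) ⟩
  lineSums g x y z ∎
  where
  α : _ → _ → _ → ℕ
  α x′ y′ z′ = adj (x ∷ y ∷ z ∷ []) (x′ ∷ y′ ∷ z′ ∷ [])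
  point : Σ³ (λ x′ y′ z′ → δ z z′ * (δ y y′ * (δ x x′ * (3 * g x′ y′ z′)))) ≡ 3 * g x y z
  point = trans (Σ³-δᶻ z (λ x′ y′ z′ → δ y y′ * (δ x x′ * (3 * g x′ y′ z′))))
         (trans (sum-cong-≗ λ x′ → sum-δ y λ y′ → δ x x′ * (3 * g x′ y′ z))
                (sum-δ x λ x′ → 3 * g x′ y z))
  pointwise : ∀ a d e f h → a + 3 * (f * (e * d)) ≡ f * e + f * d + e * d →
    a * h + f * (e * (d * (3 * h))) ≡ f * (e * h) + f * (d * h) + e * (d * h)
  pointwise a d e f h eq = trans (left a d e f h) (trans (cong (_* h) eq) (right d e f h))
    where
    left : ∀ a d e f h → a * h + f * (e * (d * (3 * h))) ≡ (a + 3 * (f * (e * d))) * h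
    left = solve-∀
    right : ∀ d e f h → (f * e + f * d + e * d) * h ≡ f * (e * h) + f * (d * h) + e * (d * h)
    right = solve-∀

length-filter-filter : ∀ {A : Set} {P Q : A → Set} (P? : ∀ x → Dec (P x)) (Q? : ∀ x → Dec (Q x)) xs →
  length (filter P? (filter Q? xs)) ≡ listSum (List.map (λ x → ι (does (P? x)) * ι (does (Q? x))) xs)
length-filter-filter P? Q? List.[] = refl
length-filter-filter P? Q? (x List.∷ xs) with does (Q? x)
... | false = trans (length-filter-filter P? Q? xs)
                    (cong (_+ listSum (List.map (λ y → ι (does (P? y)) * ι (does (Q? y))) xs)) (sym (*-zeroʳ (ι (does (P? x))))))
... | true with does (P? x)
...   | false = length-filter-filter P? Q? xs
...   | true  = cong suc (length-filter-filter P? Q? xs)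

-- The induction replaces `g` by `g ∘ suc`, which is why `g` is arbitrary; `allFin` is the case of
-- the identity.
listSum-concatMap : ∀ {A : Set} {B : Set} {n} (h : B → ℕ) (f : A → List B) (g : Fin n → A) →
  listSum (List.map h (concatMap f (tabulate g))) ≡ sum λ i → listSum (List.map h (f (g i)))
listSum-concatMap {n = zero}  h f g = refl
listSum-concatMap {n = suc n} h f g = begin
  listSum (List.map h (f (g zero) List.++ concatMap f (tabulate (g ∘ suc))))
    ≡⟨ cong listSum (map-++ h (f (g zero)) _) ⟩
  listSum (List.map h (f (g zero)) List.++ List.map h (concatMap f (tabulate (g ∘ suc))))
    ≡⟨ sum-++ (List.map h (f (g zero))) _ ⟩
  listSum (List.map h (f (g zero))) + listSum (List.map h (concatMap f (tabulate (g ∘ suc))))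
    ≡⟨ cong (listSum (List.map h (f (g zero))) +_) (listSum-concatMap h f (g ∘ suc)) ⟩
  (sum λ i → listSum (List.map h (f (g i)))) ∎

sum-allVertices-suc : ∀ n {q} (h : Vertex (suc n) q → ℕ) →
  listSum (List.map h (allVertices (suc n) q)) ≡ sum λ x → listSum (List.map (h ∘ (x ∷_)) (allVertices n q))
sum-allVertices-suc n {q} h = trans
  (listSum-concatMap h (λ x → List.map (x ∷_) (allVertices n q)) (λ i → i))
  (sum-cong-≗ {q} λ x → cong listSum (sym (map-∘ {g = h} {f = x ∷_} (allVertices n q))))

sum-allVertices : ∀ {q} (h : Vertex 3 q → ℕ) →
  listSum (List.map h (allVertices 3 q)) ≡ Σ³ λ x y z → h (x ∷ y ∷ z ∷ [])
sum-allVertices h =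
  trans (sum-allVertices-suc 2 h) $ sum-cong-≗ λ x →
  trans (sum-allVertices-suc 1 (h ∘ (x ∷_))) $ sum-cong-≗ λ y →
  trans (sum-allVertices-suc 0 (h ∘ (x ∷_) ∘ (y ∷_))) $ sum-cong-≗ λ z →
  +-identityʳ (h (x ∷ y ∷ z ∷ []))

⟦_⟧ : ∀ {q} → Code 3 q → Fin q → Fin q → Fin q → ℕ
⟦ C ⟧ x y z = ι (C (x ∷ y ∷ z ∷ []))

inside-lineSums : ∀ {q} (C : Code 3 q) x y z →
  insideNeighbours C (x ∷ y ∷ z ∷ []) + 3 * ⟦ C ⟧ x y z ≡ lineSums ⟦ C ⟧ x y z
inside-lineSums {q} C x y z = trans (cong (_+ 3 * ⟦ C ⟧ x y z) count) (neighbour-sum ⟦ C ⟧ x y z)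
  where
  v : Vertex 3 q
  v = x ∷ y ∷ z ∷ []
  ι-≟true : ∀ b → ι (does (b Bool.≟ true)) ≡ ι b
  ι-≟true true  = refl
  ι-≟true false = refl
  count : insideNeighbours C v ≡ Σ³ λ x′ y′ z′ → adj v (x′ ∷ y′ ∷ z′ ∷ []) * ⟦ C ⟧ x′ y′ z′
  count = trans (length-filter-filter (adjacent? v) (λ w → C w Bool.≟ true) (allVertices 3 q))
         (trans (sum-allVertices λ w → adj v w * ι (does (C w Bool.≟ true)))
                (Σ³-cong λ x′ y′ z′ → cong (adj v (x′ ∷ y′ ∷ z′ ∷ []) *_) (ι-≟true (C _))))

outside-lineSums : ∀ {q} (C : Code 3 q) x y z →
  outsideNeighbours C (x ∷ y ∷ z ∷ []) + 3 * ⟦ not ∘ C ⟧ x y z ≡ lineSums ⟦ not ∘ C ⟧ x y z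
outside-lineSums {q} C x y z = trans (cong (_+ 3 * ⟦ not ∘ C ⟧ x y z) count) (neighbour-sum ⟦ not ∘ C ⟧ x y z)
  where
  v : Vertex 3 q
  v = x ∷ y ∷ z ∷ []
  ι-≟false : ∀ b → ι (does (b Bool.≟ false)) ≡ ι (not b)
  ι-≟false true  = refl
  ι-≟false false = refl
  count : outsideNeighbours C v ≡ Σ³ λ x′ y′ z′ → adj v (x′ ∷ y′ ∷ z′ ∷ []) * ⟦ not ∘ C ⟧ x′ y′ z′
  count = trans (length-filter-filter (adjacent? v) (λ w → C w Bool.≟ false) (allVertices 3 q))
         (trans (sum-allVertices λ w → adj v w * ι (does (C w Bool.≟ false)))
                (Σ³-cong λ x′ y′ z′ → cong (adj v (x′ ∷ y′ ∷ z′ ∷ []) *_) (ι-≟false (C _))))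

-- Regular codes and their complements

-- Encodes both neighbour conditions when β + γ = 2q: at a codeword the lines count 3(q - 1) - β
-- neighbours in the code and the vertex three times, and 3q - β = q + γ.
Regular : ∀ {q} → Code 3 q → ℕ → Set
Regular {q} C γ = ∀ x y z → lineSums ⟦ C ⟧ x y z ≡ q * ⟦ C ⟧ x y z + γ

sum-not : ∀ {q} (b : Fin q → Bool) → sum (ι ∘ b) + sum (ι ∘ not ∘ b) ≡ q
sum-not {q} b = begin
  sum (ι ∘ b) + sum (ι ∘ not ∘ b)    ≡⟨ sym (∑-distrib-+ (ι ∘ b) _) ⟩
  sum (λ i → ι (b i) + ι (not (b i)))  ≡⟨ sum-cong-≗ (ι-not ∘ b) ⟩
  sum {q} (λ _ → 1)                  ≡⟨ trans (sum-const q 1) (*-identityʳ q) ⟩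
  q                                  ∎

lineSums-not : ∀ {q} (C : Code 3 q) x y z →
  lineSums ⟦ C ⟧ x y z + lineSums ⟦ not ∘ C ⟧ x y z ≡ 3 * q
lineSums-not {q} C x y z = begin
  lineSums ⟦ C ⟧ x y z + lineSums ⟦ not ∘ C ⟧ x y z
    ≡⟨ regroup (sum {q} _) (sum {q} _) (sum {q} _) (sum {q} _) (sum {q} _) (sum {q} _) ⟩
  (sum (λ i → ⟦ C ⟧ i y z) + sum (λ i → ⟦ not ∘ C ⟧ i y z))
    + (sum (λ i → ⟦ C ⟧ x i z) + sum (λ i → ⟦ not ∘ C ⟧ x i z))
    + (sum (λ i → ⟦ C ⟧ x y i) + sum (λ i → ⟦ not ∘ C ⟧ x y i))
    ≡⟨ cong₂ _+_ (cong₂ _+_ (sum-not λ i → C (i ∷ y ∷ z ∷ [])) (sum-not λ i → C (x ∷ i ∷ z ∷ [])))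
                 (sum-not λ i → C (x ∷ y ∷ i ∷ [])) ⟩
  q + q + q
    ≡⟨ triple q ⟩
  3 * q ∎
  where
  regroup : ∀ a b c d e f → a + b + c + (d + e + f) ≡ (a + d) + (b + e) + (c + f)
  regroup = solve-∀
  triple : ∀ q → q + q + q ≡ 3 * q
  triple = solve-∀

-- The line sums of a code and its complement total 3q = q + (β + γ), and exactly one of the two
-- contains the given vertex.
regular-not : ∀ {q} (C : Code 3 q) {β γ} → β + γ ≡ q * 2 → Regular C γ → Regular (not ∘ C) β
regular-not {q} C {β} {γ} β+γ≡2q reg x y z = +-cancelˡ-≡ (lineSums ⟦ C ⟧ x y z) _ _ $ begin
  lineSums ⟦ C ⟧ x y z + lineSums ⟦ not ∘ C ⟧ x y z  ≡⟨ lineSums-not C x y z ⟩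
  3 * q                                              ≡⟨ split q ⟩
  q * 1 + q * 2
    ≡⟨ cong₂ (λ m n → q * m + n) (sym (ι-not (C (x ∷ y ∷ z ∷ [])))) (sym β+γ≡2q) ⟩
  q * (⟦ C ⟧ x y z + ⟦ not ∘ C ⟧ x y z) + (β + γ)
    ≡⟨ regroup q (⟦ C ⟧ x y z) (⟦ not ∘ C ⟧ x y z) β γ ⟩
  (q * ⟦ C ⟧ x y z + γ) + (q * ⟦ not ∘ C ⟧ x y z + β)
    ≡⟨ cong (_+ (q * ⟦ not ∘ C ⟧ x y z + β)) (sym (reg x y z)) ⟩
  lineSums ⟦ C ⟧ x y z + (q * ⟦ not ∘ C ⟧ x y z + β) ∎
  where
  split : ∀ q → 3 * q ≡ q * 1 + q * 2
  split = solve-∀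
  regroup : ∀ q m n β γ → q * (m + n) + (β + γ) ≡ (q * m + γ) + (q * n + β)
  regroup = solve-∀

IsCRC1⇒regular : ∀ {q} (C : Code 3 q) {β γ} → β + γ ≡ q * 2 → IsCRC1 C β γ → Regular C γ
IsCRC1⇒regular {q} C {β} {γ} β+γ≡2q (_ , _ , _ , out , ins) x y z with C (x ∷ y ∷ z ∷ []) in eq
... | false = begin
  lineSums ⟦ C ⟧ x y z                  ≡⟨ sym (inside-lineSums C x y z) ⟩
  insideNeighbours C (x ∷ y ∷ z ∷ []) + 3 * ⟦ C ⟧ x y z  ≡⟨ cong₂ (λ m b → m + 3 * ι b) (ins (x ∷ y ∷ z ∷ []) eq) eq ⟩
  γ + 0                                 ≡⟨ trans (+-identityʳ γ) (cong (_+ γ) (sym (*-zeroʳ q))) ⟩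
  q * 0 + γ                             ∎
-- For a codeword only the outside neighbours are known. They give the line sums of the complement,
-- so these are added on both sides.
... | true = +-cancelʳ-≡ β _ _ $ begin
  lineSums ⟦ C ⟧ x y z + β                           ≡⟨ cong (lineSums ⟦ C ⟧ x y z +_) (sym outside) ⟩
  lineSums ⟦ C ⟧ x y z + lineSums ⟦ not ∘ C ⟧ x y z  ≡⟨ lineSums-not C x y z ⟩
  3 * q                                              ≡⟨ split q ⟩
  q * 1 + q * 2                                      ≡⟨ cong (q * 1 +_) (trans (sym β+γ≡2q) (+-comm β γ)) ⟩
  q * 1 + (γ + β)                                    ≡⟨ sym (+-assoc (q * 1) γ β) ⟩
  q * 1 + γ + β                                      ∎
  where
  split : ∀ q → 3 * q ≡ q * 1 + q * 2
  split = solve-∀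
  outside : lineSums ⟦ not ∘ C ⟧ x y z ≡ β
  outside = trans (sym (outside-lineSums C x y z))
           (trans (cong₂ (λ m b → m + 3 * ι (not b)) (out (x ∷ y ∷ z ∷ []) eq) eq) (+-identityʳ β))

regular⇒inside : ∀ {q} (C : Code 3 q) {γ} → Regular C γ → ∀ v → C v ≡ false → insideNeighbours C v ≡ γ
regular⇒inside {q} C {γ} reg (x ∷ y ∷ z ∷ []) eq = begin
  insideNeighbours C (x ∷ y ∷ z ∷ [])                     ≡⟨ sym (+-identityʳ _) ⟩
  insideNeighbours C (x ∷ y ∷ z ∷ []) + 3 * ι false       ≡⟨ cong (λ b → insideNeighbours C (x ∷ y ∷ z ∷ []) + 3 * ι b) (sym eq) ⟩
  insideNeighbours C (x ∷ y ∷ z ∷ []) + 3 * ⟦ C ⟧ x y z   ≡⟨ trans (inside-lineSums C x y z) (reg x y z) ⟩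
  q * ⟦ C ⟧ x y z + γ                      ≡⟨ cong (λ b → q * ι b + γ) eq ⟩
  q * 0 + γ                                ≡⟨ cong (_+ γ) (*-zeroʳ q) ⟩
  γ                                        ∎

regular⇒outside : ∀ {q} (C : Code 3 q) {β} → Regular (not ∘ C) β → ∀ v → C v ≡ true → outsideNeighbours C v ≡ β
regular⇒outside {q} C {β} reg (x ∷ y ∷ z ∷ []) eq = begin
  outsideNeighbours C (x ∷ y ∷ z ∷ [])                         ≡⟨ sym (+-identityʳ _) ⟩
  outsideNeighbours C (x ∷ y ∷ z ∷ []) + 3 * ι (not true)      ≡⟨ cong (λ b → outsideNeighbours C (x ∷ y ∷ z ∷ []) + 3 * ι (not b)) (sym eq) ⟩
  outsideNeighbours C (x ∷ y ∷ z ∷ []) + 3 * ⟦ not ∘ C ⟧ x y z  ≡⟨ trans (outside-lineSums C x y z) (reg x y z) ⟩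
  q * ⟦ not ∘ C ⟧ x y z + β                     ≡⟨ cong (λ b → q * ι (not b) + β) eq ⟩
  q * 0 + β                                     ≡⟨ cong (_+ β) (*-zeroʳ q) ⟩
  β                                             ∎

ι-positive : ∀ {b} → 0 < ι b → b ≡ true
ι-positive {true} _ = refl

not-true : ∀ {b} → not b ≡ true → b ≡ false
not-true {false} _ = refl

+-positive : ∀ m n → 0 < m + n → 0 < m ⊎ 0 < n
+-positive zero    n 0<n = inj₂ 0<n
+-positive (suc m) n _   = inj₁ (s≤s z≤n)

-- The three line sums at the origin total at least γ, so one of these lines contains a codeword.
regular⇒inhabited : ∀ {q} (C : Code 3 (suc q)) {γ} → 0 < γ → Regular C γ → ∃ λ v → C v ≡ true
regular⇒inhabited {q} C {γ} 0<γ reg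
  with +-positive (sum (λ i → ⟦ C ⟧ i zero zero) + sum (λ i → ⟦ C ⟧ zero i zero)) (sum (λ i → ⟦ C ⟧ zero zero i))
       (≤-trans 0<γ (≤-trans (m≤n+m γ (suc q * ⟦ C ⟧ zero zero zero)) (≤-reflexive (sym (reg zero zero zero)))))
... | inj₂ pos = let i , p = sum-positive (λ i → ⟦ C ⟧ zero zero i) pos in _ , ι-positive p
... | inj₁ pos with +-positive (sum (λ i → ⟦ C ⟧ i zero zero)) (sum (λ i → ⟦ C ⟧ zero i zero)) pos
...   | inj₁ pos′ = let i , p = sum-positive (λ i → ⟦ C ⟧ i zero zero) pos′ in _ , ι-positive p
...   | inj₂ pos′ = let i , p = sum-positive (λ i → ⟦ C ⟧ zero i zero) pos′ in _ , ι-positive p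

regular⇒IsCRC1 : ∀ {q} (C : Code 3 (suc q)) {β γ} → β + γ ≡ suc q * 2 → 0 < β → 0 < γ →
  Regular C γ → IsCRC1 C β γ
regular⇒IsCRC1 C {β} {γ} β+γ≡2q 0<β 0<γ reg =
  regular⇒inhabited C 0<γ reg ,
  (let v , p = regular⇒inhabited (not ∘ C) 0<β reg′ in v , not-true p) ,
  0<γ , regular⇒outside C reg′ , regular⇒inside C reg
  where
  reg′ = regular-not C β+γ≡2q reg

-- Codes that are unions of disjoint full lines

-- `P y z` marks the line in direction x over `(y, z)`; `Q` and `R` do the same for the directions y
-- and z, with arguments in cyclic order. `degˣ` counts the marked lines inside the plane of a fixed
-- x.
record CylinderPattern (q a b c : ℕ) : Set where
  field
    P Q R    : Fin q → Fin q → ℕ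
    disjoint : ∀ x y z → P y z + Q z x + R x y ≤ 1
    degˣ     : ∀ x → sum (λ z → Q z x) + sum (λ y → R x y) ≡ a
    degʸ     : ∀ y → sum (λ x → R x y) + sum (λ z → P y z) ≡ b
    degᶻ     : ∀ z → sum (λ y → P y z) + sum (λ x → Q z x) ≡ c

sum-const-+-+ : ∀ {n} k (f g : Fin n → ℕ) → sum (λ i → k + f i + g i) ≡ n * k + sum f + sum g
sum-const-+-+ {n} k f g = trans (∑-distrib-+ (λ i → k + f i) g)
  (cong (_+ sum g) (trans (∑-distrib-+ (λ _ → k) f) (cong (_+ sum f) (sum-const n k))))

module _ {q} (P Q R : Fin q → Fin q → ℕ) where

  cylinders : Fin q → Fin q → Fin q → ℕ
  cylinders x y z = P y z + Q z x + R x y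

  -- Along a line one of the three terms is constant and contributes `q` times its value; the other
  -- two run through a row or a column and contribute degrees.
  lineSums-cylinders : ∀ x y z → lineSums cylinders x y z ≡ q * cylinders x y z
    + ((sum (λ i → Q z i) + sum (λ i → R i y)) + (sum (λ i → P i z) + sum (λ i → R x i))
       + (sum (λ i → P y i) + sum (λ i → Q i x)))
  lineSums-cylinders x y z = begin
    lineSums cylinders x y z
      ≡⟨ cong₂ _+_ (cong₂ _+_ (sum-const-+-+ (P y z) (λ i → Q z i) (λ i → R i y))
           (trans (sum-cong-≗ λ i → cong (_+ R x i) (+-comm (P i z) (Q z x)))
                  (sum-const-+-+ (Q z x) (λ i → P i z) (λ i → R x i))))
           (trans (sum-cong-≗ λ i → rotate (P y i) (Q i x) (R x y))
                  (sum-const-+-+ (R x y) (λ i → P y i) (λ i → Q i x))) ⟩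
    q * P y z + sum (λ i → Q z i) + sum (λ i → R i y)
      + (q * Q z x + sum (λ i → P i z) + sum (λ i → R x i))
      + (q * R x y + sum (λ i → P y i) + sum (λ i → Q i x))
      ≡⟨ regroup q (P y z) (Q z x) (R x y) (sum {q} _) (sum {q} _) (sum {q} _) (sum {q} _) (sum {q} _) (sum {q} _) ⟩
    _ ∎
    where
    rotate : ∀ p q r → p + q + r ≡ r + p + q
    rotate = solve-∀
    regroup : ∀ n p q r a b c d e f →
      (n * p + a + b) + (n * q + c + d) + (n * r + e + f) ≡ n * (p + q + r) + ((a + b) + (c + d) + (e + f))
    regroup = solve-∀

lineSums-cong : ∀ {q} {g h : Fin q → Fin q → Fin q → ℕ} → (∀ x y z → g x y z ≡ h x y z) →
  ∀ x y z → lineSums g x y z ≡ lineSums h x y z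
lineSums-cong e x y z = cong₂ _+_ (cong₂ _+_ (sum-cong-≗ λ i → e i y z) (sum-cong-≗ λ i → e x i z))
                                  (sum-cong-≗ λ i → e x y i)

pattern⇒regular : ∀ {q a b c} → CylinderPattern q a b c → ∃ λ (C : Code 3 q) → Regular C (a + b + c)
pattern⇒regular {q} {a} {b} {c} pat = C , reg
  where
  open CylinderPattern pat
  positive : ℕ → Bool
  positive zero    = false
  positive (suc _) = true
  ι-positive≡ : ∀ {n} → n ≤ 1 → ι (positive n) ≡ n
  ι-positive≡ z≤n       = refl
  ι-positive≡ (s≤s z≤n) = refl
  C : Code 3 q
  C (x ∷ y ∷ z ∷ []) = positive (cylinders P Q R x y z)
  C≡ : ∀ x y z → ⟦ C ⟧ x y z ≡ cylinders P Q R x y z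
  C≡ x y z = ι-positive≡ (disjoint x y z)
  regroup : ∀ d e f g h i → (d + e) + (f + g) + (h + i) ≡ (i + g) + (e + h) + (f + d)
  regroup = solve-∀
  reg : Regular C (a + b + c)
  reg x y z = begin
    lineSums ⟦ C ⟧ x y z             ≡⟨ lineSums-cong C≡ x y z ⟩
    lineSums (cylinders P Q R) x y z ≡⟨ lineSums-cylinders P Q R x y z ⟩
    q * cylinders P Q R x y z + _    ≡⟨ cong₂ (λ m n → q * m + n) (sym (C≡ x y z))
      -- The six degrees, paired by direction so far, are paired by the coordinate to which they
      -- belong.
      (trans (regroup (sum {q} _) (sum {q} _) (sum {q} _) (sum {q} _) (sum {q} _) (sum {q} _))
             (cong₂ _+_ (cong₂ _+_ (degˣ x) (degʸ y)) (degᶻ z))) ⟩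
    q * ⟦ C ⟧ x y z + (a + b + c) ∎

-- Biregular bipartite graphs

record Biregular (m n b c : ℕ) : Set where
  field
    M    : Fin m → Fin n → ℕ
    M≤1  : ∀ i j → M i j ≤ 1
    rows : ∀ i → sum (λ j → M i j) ≡ b
    cols : ∀ j → sum (λ i → M i j) ≡ c

-- Both sides sum `h` over 0, ..., n.
sum-shift : ∀ n (h : ℕ → ℕ) → sum {n} (λ i → h (suc (toℕ i))) + h 0 ≡ sum {n} (λ i → h (toℕ i)) + h n
sum-shift zero    h = refl
sum-shift (suc n) h = begin
  h 1 + sum {n} (λ i → h (suc (suc (toℕ i)))) + h 0
    ≡⟨ rotate (h 1) (sum {n} _) (h 0) ⟩
  h 0 + (sum {n} (λ i → h (suc (suc (toℕ i)))) + h 1)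
    ≡⟨ cong (h 0 +_) (sum-shift n (h ∘ suc)) ⟩
  h 0 + (sum {n} (λ i → h (suc (toℕ i))) + h (suc n))
    ≡⟨ sym (+-assoc (h 0) _ _) ⟩
  h 0 + sum {n} (λ i → h (suc (toℕ i))) + h (suc n) ∎
  where
  rotate : ∀ a b c → a + b + c ≡ c + (b + a)
  rotate = solve-∀

sum-telescope : ∀ m (g : ℕ → ℕ) → (∀ i → g i ≤ g (suc i)) →
  sum {m} (λ i → g (suc (toℕ i)) ∸ g (toℕ i)) + g 0 ≡ g m
sum-telescope m g mono = +-cancelˡ-≡ (sum {m} λ i → g (toℕ i)) _ _ $ begin
  sum {m} (λ i → g (toℕ i)) + (sum {m} (λ i → g (suc (toℕ i)) ∸ g (toℕ i)) + g 0)
    ≡⟨ sym (+-assoc (sum {m} λ i → g (toℕ i)) _ _) ⟩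
  sum {m} (λ i → g (toℕ i)) + sum {m} (λ i → g (suc (toℕ i)) ∸ g (toℕ i)) + g 0
    ≡⟨ cong (_+ g 0) (sym (∑-distrib-+ {m} (λ i → g (toℕ i)) _)) ⟩
  sum {m} (λ i → g (toℕ i) + (g (suc (toℕ i)) ∸ g (toℕ i))) + g 0
    ≡⟨ cong (_+ g 0) (sum-cong-≗ {m} λ i → m+[n∸m]≡n (mono (toℕ i))) ⟩
  sum {m} (λ i → g (suc (toℕ i))) + g 0
    ≡⟨ sum-shift m g ⟩
  sum {m} (λ i → g (toℕ i)) + g m ∎

-- Induction on `k`: raising `k` by one shifts the window of `n` consecutive numerators, dropping
-- ⌊k/n⌋ and gaining ⌊(k + n)/n⌋, which is larger by one.
hermite-identity : ∀ n .{{_ : NonZero n}} k → sum {n} (λ j → (k + toℕ j) / n) ≡ k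
hermite-identity n zero = trans (sum-cong-≗ {n} λ j → m<n⇒m/n≡0 (Fin.toℕ<n j)) (sum-zero n)
hermite-identity n (suc k) = +-cancelʳ-≡ ((k + 0) / n) _ _ $ begin
  sum {n} (λ j → suc (k + toℕ j) / n) + (k + 0) / n
    ≡⟨ cong (_+ (k + 0) / n) (sum-cong-≗ {n} λ j → cong (_/ n) (sym (+-suc k (toℕ j)))) ⟩
  sum {n} (λ j → (k + suc (toℕ j)) / n) + (k + 0) / n
    ≡⟨ sum-shift n (λ x → (k + x) / n) ⟩
  sum {n} (λ j → (k + toℕ j) / n) + (k + n) / n
    ≡⟨ cong₂ _+_ (hermite-identity n k) (trans (+-distrib-/-∣ʳ k ∣-refl) (cong (k / n +_) (n/n≡1 n))) ⟩
  k + (k / n + 1)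
    ≡⟨ rotate k (k / n) ⟩
  suc k + k / n
    ≡⟨ cong (λ x → suc k + x / n) (sym (+-identityʳ k)) ⟩
  suc k + (k + 0) / n ∎
  where
  rotate : ∀ k x → k + (x + 1) ≡ suc k + x
  rotate = solve-∀

-- Row i takes the b cyclically consecutive columns after those used by row i - 1;
-- ⌊(ib + j)/n⌋ counts the uses of column n - 1 - j before row i, so columns are indexed in reverse.
biregular : ∀ m n .{{_ : NonZero n}} {b c} → m * b ≡ n * c → b ≤ n → Biregular m n b c
biregular m n {b} {c} mb≡nc b≤n = record
  { M    = λ i j → used (toℕ j) (suc (toℕ i)) ∸ used (toℕ j) (toℕ i)
  ; M≤1  = λ i j → m≤n+o⇒m∸n≤o _ (used (toℕ j) (toℕ i)) (step≤1 (toℕ j) (toℕ i))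
  ; rows = rows
  ; cols = cols
  }
  where
  used : ℕ → ℕ → ℕ
  used j i = (i * b + j) / n
  mono : ∀ j i → used j i ≤ used j (suc i)
  mono j i = /-monoˡ-≤ n (+-monoˡ-≤ j (m≤n+m (i * b) b))
  step≤1 : ∀ j i → used j (suc i) ≤ used j i + 1
  step≤1 j i = ≤-trans (/-monoˡ-≤ n (≤-trans (≤-reflexive (rotate b (i * b) j)) (+-monoʳ-≤ (i * b + j) b≤n)))
                       (≤-reflexive (trans (+-distrib-/-∣ʳ (i * b + j) ∣-refl) (cong (used j i +_) (n/n≡1 n))))
    where
    rotate : ∀ b x j → b + x + j ≡ x + j + b
    rotate = solve-∀
  rows : ∀ i → sum {n} (λ j → used (toℕ j) (suc (toℕ i)) ∸ used (toℕ j) (toℕ i)) ≡ b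
  -- By Hermite's identity the uses before row `i` total `toℕ i * b`, and those before the next row
  -- total `b` more.
  rows i = +-cancelˡ-≡ (toℕ i * b) _ _ $ begin
    toℕ i * b + sum {n} (λ j → used (toℕ j) (suc (toℕ i)) ∸ used (toℕ j) (toℕ i))
      ≡⟨ cong (_+ sum {n} (λ j → used (toℕ j) (suc (toℕ i)) ∸ used (toℕ j) (toℕ i)))
              (sym (hermite-identity n (toℕ i * b))) ⟩
    sum {n} (λ j → used (toℕ j) (toℕ i)) + sum {n} (λ j → used (toℕ j) (suc (toℕ i)) ∸ used (toℕ j) (toℕ i))
      ≡⟨ sym (∑-distrib-+ {n} (λ j → used (toℕ j) (toℕ i)) _) ⟩
    sum {n} (λ j → used (toℕ j) (toℕ i) + (used (toℕ j) (suc (toℕ i)) ∸ used (toℕ j) (toℕ i)))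
      ≡⟨ sum-cong-≗ {n} (λ j → m+[n∸m]≡n (mono (toℕ j) (toℕ i))) ⟩
    sum {n} (λ j → used (toℕ j) (suc (toℕ i)))
      ≡⟨ hermite-identity n (suc (toℕ i) * b) ⟩
    b + toℕ i * b
      ≡⟨ +-comm b _ ⟩
    toℕ i * b + b ∎
  cols : ∀ j → sum {m} (λ i → used (toℕ j) (suc (toℕ i)) ∸ used (toℕ j) (toℕ i)) ≡ c
  cols j = +-cancelʳ-≡ (used (toℕ j) 0) _ _ $ begin
    sum {m} (λ i → used (toℕ j) (suc (toℕ i)) ∸ used (toℕ j) (toℕ i)) + used (toℕ j) 0
      ≡⟨ sum-telescope m (used (toℕ j)) (mono (toℕ j)) ⟩
    (m * b + toℕ j) / n
      -- All rows together use a multiple of `n` positions, so they go round the columns exactly `c`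
      -- times.
      ≡⟨ cong (λ x → (x + toℕ j) / n) (trans mb≡nc (*-comm n c)) ⟩
    (c * n + toℕ j) / n
      ≡⟨ +-distrib-/-∣ˡ (toℕ j) (n∣m*n c) ⟩
    c * n / n + toℕ j / n
      ≡⟨ cong (_+ toℕ j / n) (m*n/n≡m c n) ⟩
    c + toℕ j / n ∎

-- Patterns from blocks and from Condition 1

splitBy : ∀ {m n q} → m + n ≡ q → Fin q → Fin m ⊎ Fin n
splitBy {m} refl = splitAt m

sum-splitAt : ∀ m {n} (h : Fin m ⊎ Fin n → ℕ) →
  sum (λ i → h (splitAt m i)) ≡ sum (h ∘ inj₁) + sum (h ∘ inj₂)
sum-splitAt zero    h = refl
sum-splitAt (suc m) h = trans (cong (h (inj₁ zero) +_) (sum-splitAt m (h ∘ Sum.map₁ suc)))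
                              (sym (+-assoc (h (inj₁ zero)) _ _))

sum-splitBy : ∀ {m n q} (e : m + n ≡ q) (h : Fin m ⊎ Fin n → ℕ) →
  sum (λ i → h (splitBy e i)) ≡ sum (h ∘ inj₁) + sum (h ∘ inj₂)
sum-splitBy {m} refl h = sum-splitAt m h

-- Each coordinate is cut into two blocks. Any two of the graphs use opposite blocks of the
-- coordinate they share, so their lines are disjoint and every degree comes from a single graph.
blocks⇒pattern : ∀ {q t t′ s s′ r r′ a b c} → t + t′ ≡ q → s + s′ ≡ q → r + r′ ≡ q →
  Biregular s′ r′ b c → Biregular r t′ c a → Biregular t s a b → CylinderPattern q a b c
blocks⇒pattern {q} {t} {t′} {s} {s′} {r} {r′} {a} {b} {c} eˣ eʸ eᶻ BP BQ BR = record
  { P        = λ y z → P (splitBy eʸ y) (splitBy eᶻ z)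
  ; Q        = λ z x → Q (splitBy eᶻ z) (splitBy eˣ x)
  ; R        = λ x y → R (splitBy eˣ x) (splitBy eʸ y)
  ; disjoint = λ x y z → disjoint (splitBy eˣ x) (splitBy eʸ y) (splitBy eᶻ z)
  ; degˣ     = λ x → trans (cong₂ _+_ (sum-splitBy eᶻ λ z → Q z (splitBy eˣ x)) (sum-splitBy eʸ (R (splitBy eˣ x))))
                           (degˣ (splitBy eˣ x))
  ; degʸ     = λ y → trans (cong₂ _+_ (sum-splitBy eˣ λ x → R x (splitBy eʸ y)) (sum-splitBy eᶻ (P (splitBy eʸ y))))
                           (degʸ (splitBy eʸ y))
  ; degᶻ     = λ z → trans (cong₂ _+_ (sum-splitBy eʸ λ y → P y (splitBy eᶻ z)) (sum-splitBy eˣ (Q (splitBy eᶻ z))))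
                           (degᶻ (splitBy eᶻ z))
  }
  where
  module BP = Biregular BP
  module BQ = Biregular BQ
  module BR = Biregular BR
  P : Fin s ⊎ Fin s′ → Fin r ⊎ Fin r′ → ℕ
  P (inj₂ y) (inj₂ z) = BP.M y z
  P (inj₂ y) (inj₁ z) = 0
  P (inj₁ y) z        = 0
  Q : Fin r ⊎ Fin r′ → Fin t ⊎ Fin t′ → ℕ
  Q (inj₁ z) (inj₂ x) = BQ.M z x
  Q (inj₁ z) (inj₁ x) = 0
  Q (inj₂ z) x        = 0
  R : Fin t ⊎ Fin t′ → Fin s ⊎ Fin s′ → ℕ
  R (inj₁ x) (inj₁ y) = BR.M x y
  R (inj₁ x) (inj₂ y) = 0
  R (inj₂ x) y        = 0
  disjoint : ∀ x y z → P y z + Q z x + R x y ≤ 1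
  disjoint (inj₁ x) (inj₁ y) (inj₁ z) = BR.M≤1 x y
  disjoint (inj₁ x) (inj₁ y) (inj₂ z) = BR.M≤1 x y
  disjoint (inj₁ x) (inj₂ y) (inj₁ z) = z≤n
  disjoint (inj₁ x) (inj₂ y) (inj₂ z) rewrite +-identityʳ (BP.M y z) | +-identityʳ (BP.M y z) = BP.M≤1 y z
  disjoint (inj₂ x) (inj₁ y) (inj₁ z) rewrite +-identityʳ (BQ.M z x) = BQ.M≤1 z x
  disjoint (inj₂ x) (inj₁ y) (inj₂ z) = z≤n
  disjoint (inj₂ x) (inj₂ y) (inj₁ z) rewrite +-identityʳ (BQ.M z x) = BQ.M≤1 z x
  disjoint (inj₂ x) (inj₂ y) (inj₂ z) rewrite +-identityʳ (BP.M y z) | +-identityʳ (BP.M y z) = BP.M≤1 y z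
  degˣ : ∀ x → (sum (λ z → Q (inj₁ z) x) + sum (λ z → Q (inj₂ z) x)) + (sum (R x ∘ inj₁) + sum (R x ∘ inj₂)) ≡ a
  degˣ (inj₁ x) rewrite sum-zero r | sum-zero r′ | sum-zero s′ | BR.rows x = +-identityʳ a
  degˣ (inj₂ x) rewrite sum-zero r′ | sum-zero s | sum-zero s′ | BQ.cols x = trans (+-identityʳ _) (+-identityʳ a)
  degʸ : ∀ y → (sum (λ x → R (inj₁ x) y) + sum (λ x → R (inj₂ x) y)) + (sum (P y ∘ inj₁) + sum (P y ∘ inj₂)) ≡ b
  degʸ (inj₁ y) rewrite sum-zero t′ | sum-zero r | sum-zero r′ | BR.cols y = trans (+-identityʳ _) (+-identityʳ b)
  degʸ (inj₂ y) rewrite sum-zero t | sum-zero t′ | sum-zero r | BP.rows y = refl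
  degᶻ : ∀ z → (sum (λ y → P (inj₁ y) z) + sum (λ y → P (inj₂ y) z)) + (sum (Q z ∘ inj₁) + sum (Q z ∘ inj₂)) ≡ c
  degᶻ (inj₁ z) rewrite sum-zero s | sum-zero s′ | sum-zero t | BQ.rows z = refl
  degᶻ (inj₂ z) rewrite sum-zero s | sum-zero t | sum-zero t′ | BP.cols z = +-identityʳ c

-- The numbers t, s, r are the sizes of the first blocks of x, y, z, and the three equations of
-- Condition 1 are the edge counts that `biregular` requires.
condition1⇒pattern : ∀ {q γ} → Condition1 q γ →
  ∃ λ a → ∃ λ b → ∃ λ c → CylinderPattern q a b c × γ ≡ a + b + c
condition1⇒pattern {q}
  (r , s , t , a , b , c , _ , r<q , 0<s , s<q , _ , t<q , _ , _ , c≤t′ , _ , _ , b≤r′ , _ , _ , a≤s , cr≡at′ , bs′≡cr′ , at≡bs , γ≡) =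
  a , b , c ,
  blocks⇒pattern (m+[n∸m]≡n (<⇒≤ t<q)) (m+[n∸m]≡n s≤q) (m+[n∸m]≡n (<⇒≤ r<q))
    (biregular (q ∸ s) (q ∸ r) {{>-nonZero (m<n⇒0<n∸m r<q)}} (flip-≡ (q ∸ s) (q ∸ r) bs′≡cr′) b≤r′)
    (biregular r (q ∸ t) {{>-nonZero (m<n⇒0<n∸m t<q)}} (flip-≡ r (q ∸ t) cr≡at′) c≤t′)
    (biregular t s {{>-nonZero 0<s}} (flip-≡ t s at≡bs) a≤s) ,
  γ≡
  where
  s≤q : s ≤ q
  s≤q = <⇒≤ s<q
  flip-≡ : ∀ m n {b c} → b * m ≡ c * n → m * b ≡ n * c
  flip-≡ m n {b} {c} eq = trans (*-comm m b) (trans eq (*-comm c n))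

latinPattern : ∀ q .{{_ : NonZero q}} m → m ≤ q → CylinderPattern q 0 m m
latinPattern q m m≤q = record
  { P        = M
  ; Q        = λ _ _ → 0
  ; R        = λ _ _ → 0
  ; disjoint = λ x y z → ≤-trans (≤-reflexive (trans (+-identityʳ _) (+-identityʳ _))) (M≤1 y z)
  ; degˣ     = λ _ → cong₂ _+_ (sum-zero q) (sum-zero q)
  ; degʸ     = λ y → cong₂ _+_ (sum-zero q) (rows y)
  ; degᶻ     = λ z → trans (cong₂ _+_ (cols z) (sum-zero q)) (+-identityʳ m)
  }
  where open Biregular (biregular q q {m} refl m≤q)

-- With q = 2p the resulting parameter is q + b, so the complementary code has parameter q - b; this
-- covers the range from p to q - 1.
halfCondition1 : ∀ p b → 0 < b → b ≤ p → Condition1 (p + p) (p + b + p)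
-- Halving the y coordinate (s = p) with a = c = p leaves t = b and r = q - b; the edge counts are
-- then pb, pb and p(q - b).
halfCondition1 p b 0<b b≤p = q ∸ b , p , b , p , b , p ,
  m<n⇒0<n∸m b<q , ∸-monoʳ-< 0<b b≤q , 0<p , m<m+n p 0<p , 0<b , b<q ,
  0<p , ≤-reflexive (sym q∸p) , p≤q∸b ,
  0<b , ≤-refl , ≤-reflexive (sym (m∸[m∸n]≡n b≤q)) ,
  0<p , p≤q∸b , ≤-refl ,
  refl , trans (cong (b *_) q∸p) (trans (*-comm b p) (cong (p *_) (sym (m∸[m∸n]≡n b≤q)))) , *-comm p b , refl
  where
  q = p + p
  0<p : 0 < p
  0<p = ≤-trans 0<b b≤p
  b<q : b < q
  b<q = ≤-<-trans b≤p (m<m+n p 0<p)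
  b≤q = <⇒≤ b<q
  q∸p : q ∸ p ≡ p
  q∸p = m+n∸n≡m p p
  p≤q∸b : p ≤ q ∸ b
  p≤q∸b = ≤-trans (≤-reflexive (sym q∸p)) (∸-monoʳ-≤ q b≤p)

-- Necessity

-- Summing the regularity equation along a line in direction x, that line contributes equally to
-- both sides and cancels, while the other lines sweep out the two planes through it. A general `g`
-- allows permuting the coordinates.
planeSums : ∀ {q} (g : Fin q → Fin q → Fin q → ℕ) {γ} →
  (∀ x y z → lineSums g x y z ≡ q * g x y z + γ) → ∀ y z →
  (sum λ x → sum λ i → g x i z) + (sum λ x → sum λ i → g x y i) ≡ q * γ
planeSums {q} g {γ} reg y z = +-cancelˡ-≡ (q * sum (λ i → g i y z)) _ _ $ begin
  q * sum (λ i → g i y z) + ((sum λ x → sum λ i → g x i z) + (sum λ x → sum λ i → g x y i))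
    ≡⟨ sym (+-assoc (q * sum (λ i → g i y z)) _ _) ⟩
  q * sum (λ i → g i y z) + (sum λ x → sum λ i → g x i z) + (sum λ x → sum λ i → g x y i)
    ≡⟨ sym (sum-const-+-+ (sum λ i → g i y z) (λ x → sum λ i → g x i z) (λ x → sum λ i → g x y i)) ⟩
  (sum λ x → lineSums g x y z)
    ≡⟨ sum-cong-≗ (λ x → reg x y z) ⟩
  (sum λ x → q * g x y z + γ)
    ≡⟨ ∑-distrib-+ (λ x → q * g x y z) (λ _ → γ) ⟩
  (sum λ x → q * g x y z) + sum {q} (λ _ → γ)
    ≡⟨ cong₂ _+_ (sym (*-distribˡ-sum q λ i → g i y z)) (sum-const q γ) ⟩
  q * sum (λ i → g i y z) + q * γ ∎

-- The three pairs of orthogonal plane sums all equal qγ, so each plane sum is qγ/2.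
regular⇒2∣qγ : ∀ {q} (C : Code 3 (suc q)) {γ} → Regular C γ → 2 ∣ suc q * γ
regular⇒2∣qγ {q} C {γ} reg = divides Hˣ $ begin
  suc q * γ  ≡⟨ sym zy ⟩
  Hᶻ + Hʸ    ≡⟨ cong (_+ Hʸ) Hᶻ≡Hˣ ⟩
  Hˣ + Hʸ    ≡⟨ cong (Hˣ +_) Hʸ≡Hˣ ⟩
  Hˣ + Hˣ    ≡⟨ double Hˣ ⟩
  Hˣ * 2     ∎
  where
  g : Fin (suc q) → Fin (suc q) → Fin (suc q) → ℕ
  g = ⟦ C ⟧
  Hˣ Hʸ Hᶻ : ℕ
  Hˣ = sum λ y → sum λ z → g zero y z
  Hʸ = sum λ x → sum λ z → g x zero z
  Hᶻ = sum λ x → sum λ y → g x y zero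
  swapˣʸ : ∀ a b c → a + b + c ≡ b + a + c
  swapˣʸ = solve-∀
  swapˣᶻ : ∀ a b c → a + b + c ≡ c + b + a
  swapˣᶻ = solve-∀
  zy : Hᶻ + Hʸ ≡ suc q * γ
  zy = planeSums g reg zero zero
  zx : Hᶻ + Hˣ ≡ suc q * γ
  zx = trans (cong (_+ Hˣ) (∑-comm λ x y → g x y zero))
             (planeSums (λ x y z → g y x z)
               (λ x y z → trans (swapˣʸ (sum λ i → g y i z) (sum λ i → g i x z) (sum λ i → g y x i)) (reg y x z)) zero zero)
  xy : Hˣ + Hʸ ≡ suc q * γ
  xy = trans (cong₂ _+_ (∑-comm λ y z → g zero y z) (∑-comm λ x z → g x zero z))
             (planeSums (λ x y z → g z y x)
               (λ x y z → trans (swapˣᶻ (sum λ i → g z y i) (sum λ i → g z i x) (sum λ i → g i y x)) (reg z y x)) zero zero)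
  Hʸ≡Hˣ : Hʸ ≡ Hˣ
  Hʸ≡Hˣ = +-cancelˡ-≡ Hᶻ _ _ (trans zy (sym zx))
  Hᶻ≡Hˣ : Hᶻ ≡ Hˣ
  Hᶻ≡Hˣ = +-cancelʳ-≡ Hʸ _ _ (trans zy (sym xy))

-- Decomposition into full lines when 2γ < q

some-false-or-full : ∀ {n} (b : Fin n → Bool) → (∃ λ i → b i ≡ false) ⊎ sum (ι ∘ b) ≡ n
some-false-or-full {zero}  b = inj₂ refl
some-false-or-full {suc n} b with b zero in eq
... | false = inj₁ (zero , eq)
... | true  = Sum.map (λ (i , p) → suc i , p) (cong suc) (some-false-or-full (b ∘ suc))

isFull : ℕ → ℕ → ℕ
isFull q n = ι (does (n ≟ q))

-- A division by `q` in which a full line has quotient 1 and remainder 0, and a sparse line has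
-- quotient 0.
fullness : ∀ {q γ n} → γ < q → n ≤ γ ⊎ n ≡ q → ∃ λ k → k ≤ γ × n ≡ q * isFull q n + k
fullness {q} γ<q (inj₂ refl) = 0 , z≤n , sym (trans (+-identityʳ _)
  (trans (cong (λ b → q * ι b) (dec-true (q ≟ q) refl)) (*-identityʳ q)))
fullness {q} {n = n} γ<q (inj₁ n≤γ) = n , n≤γ , sym (cong (_+ n)
  (trans (cong (λ b → q * ι b) (dec-false (n ≟ q) (<⇒≢ (≤-<-trans n≤γ γ<q)))) (*-zeroʳ q)))

-- If e < k, the left side is at least q(e + 1), which exceeds qe + γ. If e = 1 and k = 0, then m =
-- q + γ > 3γ.
quotient-unique : ∀ {q γ k e m} → γ + γ < q → e ≤ 1 → m ≤ γ + γ + γ → q * k + m ≡ q * e + γ → e ≡ k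
quotient-unique {q} {γ} {k} {e} {m} 2γ<q e≤1 m≤3γ eq with <-cmp e k
... | tri≈ _ e≡k _ = e≡k
... | tri< e<k _ _ = contradiction eq (>⇒≢ (≤-trans (+-monoʳ-< (q * e) (≤-<-trans (m≤m+n γ γ) 2γ<q))
        (≤-trans (≤-reflexive (trans (+-comm (q * e) q) (sym (*-suc q e)))) (≤-trans (*-monoʳ-≤ q e<k) (m≤m+n (q * k) m)))))
quotient-unique {q} {γ} {zero} {suc zero} {m} 2γ<q (s≤s z≤n) m≤3γ eq | tri> _ _ _ =
  contradiction (trans (cong (_+ m) (sym (*-zeroʳ q))) (trans eq (cong (_+ γ) (*-identityʳ q))))
                (<⇒≢ (≤-<-trans m≤3γ (+-monoˡ-< γ 2γ<q)))
quotient-unique {k = suc k} {e = suc zero} 2γ<q (s≤s z≤n) m≤3γ eq | tri> _ _ (s≤s ())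

-- A line meeting the complement has at most γ codewords; since 2γ < q, a codeword, whose three
-- line sums add up to q + γ, lies on exactly one line contained in C.
regular⇒pattern : ∀ {q} (C : Code 3 (suc q)) {γ} → Regular C γ → γ + γ < suc q →
  ∃ λ a → ∃ λ b → ∃ λ c → CylinderPattern (suc q) a b c × a + b + c ≡ γ
regular⇒pattern {q-1} C {γ} reg 2γ<q = degX zero , degY zero , degZ zero , record
  { P        = P
  ; Q        = Q
  ; R        = R
  ; disjoint = λ x y z → ≤-trans (≤-reflexive (sym (C≡ x y z))) (ι≤1 _)
  -- The three degrees total γ at every vertex, so varying one coordinate alone shows that its
  -- degree is constant.
  ; degˣ     = λ x → +-cancelʳ-≡ (degY zero) _ _ (+-cancelʳ-≡ (degZ zero) _ _ (trans (degs x zero zero) (sym (degs zero zero zero))))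
  ; degʸ     = λ y → +-cancelˡ-≡ (degX zero) _ _ (+-cancelʳ-≡ (degZ zero) _ _ (trans (degs zero y zero) (sym (degs zero zero zero))))
  ; degᶻ     = λ z → +-cancelˡ-≡ (degX zero + degY zero) _ _ (trans (degs zero zero z) (sym (degs zero zero zero)))
  } , degs zero zero zero
  where
  q = suc q-1
  γ<q : γ < q
  γ<q = ≤-<-trans (m≤m+n γ γ) 2γ<q
  lineˣ lineʸ lineᶻ : Fin q → Fin q → ℕ
  lineˣ y z = sum λ i → ⟦ C ⟧ i y z
  lineʸ z x = sum λ i → ⟦ C ⟧ x i z
  lineᶻ x y = sum λ i → ⟦ C ⟧ x y i
  lines≡γ : ∀ {x y z} → C (x ∷ y ∷ z ∷ []) ≡ false → lineˣ y z + lineʸ z x + lineᶻ x y ≡ γ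
  lines≡γ {x} {y} {z} p = trans (reg x y z) (trans (cong (λ b → q * ι b + γ) p) (cong (_+ γ) (*-zeroʳ q)))
  sparseˣ : ∀ y z → lineˣ y z ≤ γ ⊎ lineˣ y z ≡ q
  sparseˣ y z = Sum.map₁ (λ (i , p) → subst (lineˣ y z ≤_) (lines≡γ p) (≤-trans (m≤m+n _ (lineʸ z i)) (m≤m+n _ (lineᶻ i y))))
                         (some-false-or-full λ i → C (i ∷ y ∷ z ∷ []))
  sparseʸ : ∀ z x → lineʸ z x ≤ γ ⊎ lineʸ z x ≡ q
  sparseʸ z x = Sum.map₁ (λ (i , p) → subst (lineʸ z x ≤_) (lines≡γ p) (≤-trans (m≤n+m _ (lineˣ i z)) (m≤m+n _ (lineᶻ x i))))
                         (some-false-or-full λ i → C (x ∷ i ∷ z ∷ []))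
  sparseᶻ : ∀ x y → lineᶻ x y ≤ γ ⊎ lineᶻ x y ≡ q
  sparseᶻ x y = Sum.map₁ (λ (i , p) → subst (lineᶻ x y ≤_) (lines≡γ p) (m≤n+m _ (lineˣ y i + lineʸ i x)))
                         (some-false-or-full λ i → C (x ∷ y ∷ i ∷ []))
  P Q R : Fin q → Fin q → ℕ
  P y z = isFull q (lineˣ y z)
  Q z x = isFull q (lineʸ z x)
  R x y = isFull q (lineᶻ x y)
  C≡ : ∀ x y z → ⟦ C ⟧ x y z ≡ cylinders P Q R x y z
  -- The three remainders total at most 3γ, so the number of full lines through the vertex can be
  -- compared with the indicator of the code.
  C≡ x y z = quotient-unique 2γ<q (ι≤1 _) (+-mono-≤ (+-mono-≤ i≤γ j≤γ) k≤γ) $ begin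
    q * (P y z + Q z x + R x y) + (i + j + k)
      ≡⟨ regroup q (P y z) (Q z x) (R x y) i j k ⟩
    (q * P y z + i) + (q * Q z x + j) + (q * R x y + k)
      ≡⟨ sym (cong₂ _+_ (cong₂ _+_ lineˣ≡ lineʸ≡) lineᶻ≡) ⟩
    lineˣ y z + lineʸ z x + lineᶻ x y
      ≡⟨ reg x y z ⟩
    q * ⟦ C ⟧ x y z + γ ∎
    where
    decomp : ∀ n → n ≤ γ ⊎ n ≡ q → ∃ λ k → k ≤ γ × n ≡ q * isFull q n + k
    decomp n = fullness γ<q
    i   = proj₁ (decomp (lineˣ y z) (sparseˣ y z))
    j   = proj₁ (decomp (lineʸ z x) (sparseʸ z x))
    k   = proj₁ (decomp (lineᶻ x y) (sparseᶻ x y))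
    i≤γ = proj₁ (proj₂ (decomp (lineˣ y z) (sparseˣ y z)))
    j≤γ = proj₁ (proj₂ (decomp (lineʸ z x) (sparseʸ z x)))
    k≤γ = proj₁ (proj₂ (decomp (lineᶻ x y) (sparseᶻ x y)))
    lineˣ≡ = proj₂ (proj₂ (decomp (lineˣ y z) (sparseˣ y z)))
    lineʸ≡ = proj₂ (proj₂ (decomp (lineʸ z x) (sparseʸ z x)))
    lineᶻ≡ = proj₂ (proj₂ (decomp (lineᶻ x y) (sparseᶻ x y)))
    regroup : ∀ q a b c i j k → q * (a + b + c) + (i + j + k) ≡ (q * a + i) + (q * b + j) + (q * c + k)
    regroup = solve-∀
  degX degY degZ : Fin q → ℕ
  degX x = sum (λ z → Q z x) + sum (λ y → R x y)
  degY y = sum (λ x → R x y) + sum (λ z → P y z)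
  degZ z = sum (λ y → P y z) + sum (λ x → Q z x)
  degs : ∀ x y z → degX x + degY y + degZ z ≡ γ
  degs x y z = +-cancelˡ-≡ (q * ⟦ C ⟧ x y z) _ _ $ begin
    q * ⟦ C ⟧ x y z + (degX x + degY y + degZ z)
      ≡⟨ cong₂ (λ m n → q * m + n) (C≡ x y z)
           (regroup (sum λ z → Q z x) (sum λ y → R x y) (sum λ x → R x y) (sum λ z → P y z) (sum λ y → P y z) (sum λ x → Q z x)) ⟩
    q * cylinders P Q R x y z
      + ((sum (λ i → Q z i) + sum (λ i → R i y)) + (sum (λ i → P i z) + sum (λ i → R x i)) + (sum (λ i → P y i) + sum (λ i → Q i x)))
      ≡⟨ sym (lineSums-cylinders P Q R x y z) ⟩
    lineSums (cylinders P Q R) x y z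
      ≡⟨ sym (lineSums-cong C≡ x y z) ⟩
    lineSums ⟦ C ⟧ x y z
      ≡⟨ reg x y z ⟩
    q * ⟦ C ⟧ x y z + γ ∎
    where
    regroup : ∀ a b c d e f → (a + b) + (c + d) + (e + f) ≡ (f + c) + (e + b) + (d + a)
    regroup = solve-∀

-- Condition 1 from a pattern

exclusive : ∀ {m n} (f : Fin m → ℕ) (g : Fin n → ℕ) → (∀ i j → f i + g j ≤ 1) → sum f ≡ 0 ⊎ sum g ≡ 0
exclusive {n = n} f g h with sum f in eq
... | zero  = inj₁ refl
... | suc _ = inj₂ (trans (sum-cong-≗ g≡0) (sum-zero n))
  where
  positive = sum-positive f (subst (0 <_) (sym eq) (s≤s z≤n))
  g≡0 : ∀ j → g j ≡ 0
  g≡0 j = n≤0⇒n≡0 (≤-pred (≤-trans (+-monoˡ-≤ (g j) (proj₂ positive)) (h (proj₁ positive) j)))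

-- Recovers the two blocks of a coordinate: `b` records which of the two graphs supplies the degree.
splitDegrees : ∀ {n} a (f g : Fin n → ℕ) → (∀ i → f i ≡ 0 ⊎ g i ≡ 0) → (∀ i → f i + g i ≡ a) →
  ∃ λ (b : Fin n → Bool) → (∀ i → f i ≡ a * ι (b i)) × (∀ i → g i ≡ a * ι (not (b i)))
splitDegrees a f g zeros f+g≡a = (proj₁ ∘ choose) , (proj₁ ∘ proj₂ ∘ choose) , (proj₂ ∘ proj₂ ∘ choose)
  where
  choose : ∀ i → ∃ λ b → f i ≡ a * ι b × g i ≡ a * ι (not b)
  choose i with zeros i
  ... | inj₁ f≡0 = false , trans f≡0 (sym (*-zeroʳ a)) ,
                   trans (cong (_+ g i) (sym f≡0)) (trans (f+g≡a i) (sym (*-identityʳ a)))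
  ... | inj₂ g≡0 = true , trans (sym (+-identityʳ (f i))) (trans (cong (f i +_) (sym g≡0)) (trans (f+g≡a i) (sym (*-identityʳ a)))) ,
                   trans g≡0 (sym (*-zeroʳ a))

module _ {m n} (M : Fin m → Fin n → ℕ) b c {μ : Fin m → ℕ} {ν : Fin n → ℕ}
         (rows : ∀ i → sum (λ j → M i j) ≡ b * μ i) (cols : ∀ j → sum (λ i → M i j) ≡ c * ν j) where

  double-counting : b * sum μ ≡ c * sum ν
  double-counting = begin
    b * sum μ                    ≡⟨ *-distribˡ-sum b μ ⟩
    (sum λ i → b * μ i)          ≡⟨ sym (sum-cong-≗ rows) ⟩
    (sum λ i → sum λ j → M i j)  ≡⟨ ∑-comm M ⟩
    (sum λ j → sum λ i → M i j)  ≡⟨ sum-cong-≗ cols ⟩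
    (sum λ j → c * ν j)          ≡⟨ sym (*-distribˡ-sum c ν) ⟩
    c * sum ν                    ∎

  -- A row with positive `μ` has sum at least `b`, and its entries are at most 1 and vanish in
  -- columns where `ν` does.
  rowDegree≤ : (∀ i j → M i j ≤ 1) → 0 < sum μ → b ≤ sum ν
  rowDegree≤ M≤1 0<Σμ = ≤-trans (m≤m*n b (μ i) {{>-nonZero 0<μi}}) (≤-trans (≤-reflexive (sym (rows i))) (sum-mono M≤ν))
    where
    i = proj₁ (sum-positive μ 0<Σμ)
    0<μi = proj₂ (sum-positive μ 0<Σμ)
    M≤ν : ∀ j → M i j ≤ ν j
    M≤ν j with ν j in eq
    ... | suc _ = ≤-trans (M≤1 i j) (s≤s z≤n)
    ... | zero  = ≤-trans (term≤sum (λ i → M i j) i)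
                          (≤-reflexive (trans (cols j) (trans (cong (c *_) eq) (*-zeroʳ c))))

even-sum : ∀ {m n k} → m + n ≡ k → 2 ∣ (m + n + k)
even-sum {m} {n} {k} eq = divides k (trans (cong (_+ k) eq) (double k))

*-positive⁻¹ : ∀ m n → 0 < m * n → 0 < m × 0 < n
*-positive⁻¹ (suc m) (suc n) _ = s≤s z≤n , s≤s z≤n
*-positive⁻¹ (suc m) zero    h = contradiction h (<⇒≱ (s≤s (≤-reflexive (*-zeroʳ m))))

-- `U`, `V`, `W` stand for the edge counts of the three graphs. If `U` were 0, then qa + qb = V + W
-- = qc, so a + b = c and the total would be even.
odd⇒positive : ∀ {q a b c U V W} .{{_ : NonZero q}} → ¬ 2 ∣ (a + b + c) →
  q * a ≡ U + V → q * b ≡ U + W → q * c ≡ V + W → 0 < U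
odd⇒positive {U = suc _} _ _ _ _ = s≤s z≤n
odd⇒positive {q} {a} {b} {U = zero} odd qa qb qc = contradiction (even-sum {a} {b} (*-cancelˡ-≡ _ _ q
  (trans (*-distribˡ-+ q a b) (trans (cong₂ _+_ qa qb) (sym qc))))) odd

splitDegrees⇒condition1 : ∀ {q a b c} .{{_ : NonZero q}} (P Q R : Fin q → Fin q → ℕ) →
  (∀ y z → P y z ≤ 1) → (∀ z x → Q z x ≤ 1) → (∀ x y → R x y ≤ 1) →
  (ξ η ζ : Fin q → Bool) →
  (∀ x → sum (λ y → R x y) ≡ a * ι (ξ x)) → (∀ x → sum (λ z → Q z x) ≡ a * ι (not (ξ x))) →
  (∀ y → sum (λ x → R x y) ≡ b * ι (η y)) → (∀ y → sum (λ z → P y z) ≡ b * ι (not (η y))) →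
  (∀ z → sum (λ x → Q z x) ≡ c * ι (ζ z)) → (∀ z → sum (λ y → P y z) ≡ c * ι (not (ζ z))) →
  ¬ 2 ∣ (a + b + c) → Condition1 q (a + b + c)
splitDegrees⇒condition1 {q} {a} {b} {c} P Q R P≤1 Q≤1 R≤1 ξ η ζ rowsᴿ colsᵠ colsᴿ rowsᴾ rowsᵠ colsᴾ odd =
  r , s , t , a , b , c ,
  0<r , r<q , 0<s , s<q , 0<t , t<q ,
  -- Each upper bound is `rowDegree≤` for one of the graphs or its transpose.
  0<c , subst (c ≤_) s′≡ (rowDegree≤ (λ z y → P y z) c b colsᴾ rowsᴾ (λ z y → P≤1 y z) 0<r′) ,
        subst (c ≤_) t′≡ (rowDegree≤ Q c a rowsᵠ colsᵠ Q≤1 0<r) ,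
  0<b , rowDegree≤ (λ y x → R x y) b a colsᴿ rowsᴿ (λ y x → R≤1 x y) 0<s ,
        subst (b ≤_) r′≡ (rowDegree≤ P b c rowsᴾ colsᴾ P≤1 0<s′) ,
  0<a , rowDegree≤ (λ x z → Q z x) a c colsᵠ rowsᵠ (λ x z → Q≤1 z x) 0<t′ ,
        rowDegree≤ R a b rowsᴿ colsᴿ R≤1 0<t ,
  subst (λ x → c * r ≡ a * x) t′≡ cr≡at′ ,
  subst (λ x → b * x ≡ c * (q ∸ r)) s′≡ (subst (λ x → b * s′ ≡ c * x) r′≡ bs′≡cr′) ,
  at≡bs , refl
  where
  t t′ s s′ r r′ : ℕ
  t  = sum (ι ∘ ξ)
  t′ = sum (ι ∘ not ∘ ξ)
  s  = sum (ι ∘ η)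
  s′ = sum (ι ∘ not ∘ η)
  r  = sum (ι ∘ ζ)
  r′ = sum (ι ∘ not ∘ ζ)
  at≡bs : a * t ≡ b * s
  at≡bs = double-counting R a b rowsᴿ colsᴿ
  bs′≡cr′ : b * s′ ≡ c * r′
  bs′≡cr′ = double-counting P b c rowsᴾ colsᴾ
  cr≡at′ : c * r ≡ a * t′
  cr≡at′ = double-counting Q c a rowsᵠ colsᵠ
  complement : ∀ (β : Fin q → Bool) → sum (ι ∘ not ∘ β) ≡ q ∸ sum (ι ∘ β)
  complement β = sym (trans (cong (_∸ sum (ι ∘ β)) (sym (sum-not β))) (m+n∸m≡n (sum (ι ∘ β)) _))
  t′≡ : t′ ≡ q ∸ t
  t′≡ = complement ξ
  s′≡ : s′ ≡ q ∸ s
  s′≡ = complement η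
  r′≡ : r′ ≡ q ∸ r
  r′≡ = complement ζ
  total : ∀ d (β : Fin q → Bool) → q * d ≡ d * sum (ι ∘ β) + d * sum (ι ∘ not ∘ β)
  total d β = trans (*-comm q d) (trans (cong (d *_) (sym (sum-not β))) (*-distribˡ-+ d (sum (ι ∘ β)) _))
  qa : q * a ≡ a * t + c * r
  -- All x-degrees together count the edges of `R` and `Q`; the next two equations do this for y and
  -- z.
  qa = trans (total a ξ) (cong (λ v → a * t + v) (sym cr≡at′))
  qb : q * b ≡ a * t + b * s′
  qb = trans (total b η) (cong (λ u → u + b * s′) (sym at≡bs))
  qc : q * c ≡ c * r + b * s′
  qc = trans (total c ζ) (cong (λ w → c * r + w) (sym bs′≡cr′))
  acb : ∀ a b c → a + c + b ≡ a + b + c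
  acb = solve-∀
  bca : ∀ a b c → b + c + a ≡ a + b + c
  bca = solve-∀
  positive : 0 < a * t × 0 < c * r × 0 < b * s′
  positive =
    odd⇒positive odd qa qb qc ,
    odd⇒positive (odd ∘ subst (2 ∣_) (acb a b c)) (trans qa (+-comm (a * t) _)) qc qb ,
    odd⇒positive (odd ∘ subst (2 ∣_) (bca a b c))
      (trans qb (+-comm (a * t) _)) (trans qc (+-comm (c * r) _)) qa
  0<a  = proj₁ (*-positive⁻¹ a t (proj₁ positive))
  0<t  = proj₂ (*-positive⁻¹ a t (proj₁ positive))
  0<c  = proj₁ (*-positive⁻¹ c r (proj₁ (proj₂ positive)))
  0<r  = proj₂ (*-positive⁻¹ c r (proj₁ (proj₂ positive)))
  0<b  = proj₁ (*-positive⁻¹ b s′ (proj₂ (proj₂ positive)))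
  0<s′ = proj₂ (*-positive⁻¹ b s′ (proj₂ (proj₂ positive)))
  0<s  = proj₂ (*-positive⁻¹ b s (subst (0 <_) at≡bs (proj₁ positive)))
  0<t′ = proj₂ (*-positive⁻¹ a t′ (subst (0 <_) cr≡at′ (proj₁ (proj₂ positive))))
  0<r′ = proj₂ (*-positive⁻¹ c r′ (subst (0 <_) bs′≡cr′ (proj₂ (proj₂ positive))))
  proper : ∀ (β : Fin q → Bool) → 0 < sum (ι ∘ not ∘ β) → sum (ι ∘ β) < q
  proper β 0<β′ = subst (sum (ι ∘ β) <_) (sum-not β) (m<m+n _ 0<β′)
  t<q = proper ξ 0<t′
  s<q = proper η 0<s′
  r<q = proper ζ 0<r′

-- In a plane of fixed x every line of `Q` meets every line of `R`, so disjointness leaves at most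
-- one of the two kinds there; the same holds for y and z.
pattern⇒condition1 : ∀ {q a b c} .{{_ : NonZero q}} → CylinderPattern q a b c → ¬ 2 ∣ (a + b + c) →
  Condition1 q (a + b + c)
pattern⇒condition1 {q} {a} {b} {c} pat odd =
  let ξ , rowsᴿ , colsᵠ = splitDegrees a (λ x → sum λ y → R x y) (λ x → sum λ z → Q z x)
        (λ x → exclusive (λ y → R x y) (λ z → Q z x) λ y z →
          ≤-trans (≤-trans (m≤n+m _ (P y z)) (≤-reflexive (pqrˣ (P y z) (Q z x) (R x y)))) (disjoint x y z))
        (λ x → trans (+-comm (sum λ y → R x y) _) (degˣ x))
      η , colsᴿ , rowsᴾ = splitDegrees b (λ y → sum λ x → R x y) (λ y → sum λ z → P y z)
        (λ y → exclusive (λ x → R x y) (λ z → P y z) λ x z →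
          ≤-trans (≤-trans (m≤n+m _ (Q z x)) (≤-reflexive (pqrʸ (P y z) (Q z x) (R x y)))) (disjoint x y z))
        degʸ
      ζ , rowsᵠ , colsᴾ = splitDegrees c (λ z → sum λ x → Q z x) (λ z → sum λ y → P y z)
        (λ z → exclusive (λ x → Q z x) (λ y → P y z) λ x y →
          ≤-trans (≤-trans (m≤n+m _ (R x y)) (≤-reflexive (pqrᶻ (P y z) (Q z x) (R x y)))) (disjoint x y z))
        (λ z → trans (+-comm (sum λ x → Q z x) _) (degᶻ z))
  in splitDegrees⇒condition1 {a = a} {b} {c} P Q R P≤1 Q≤1 R≤1 ξ η ζ rowsᴿ colsᵠ colsᴿ rowsᴾ rowsᵠ colsᴾ odd
  where
  open CylinderPattern pat
  P≤1 : ∀ y z → P y z ≤ 1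
  P≤1 y z = ≤-trans (≤-trans (m≤m+n _ (Q z y)) (m≤m+n _ (R y y))) (disjoint y y z)
  Q≤1 : ∀ z x → Q z x ≤ 1
  Q≤1 z x = ≤-trans (≤-trans (m≤n+m _ (P x z)) (m≤m+n _ (R x x))) (disjoint x x z)
  R≤1 : ∀ x y → R x y ≤ 1
  R≤1 x y = ≤-trans (m≤n+m _ (P y x + Q x x)) (disjoint x y x)
  pqrˣ : ∀ p q r → p + (r + q) ≡ p + q + r
  pqrˣ = solve-∀
  pqrʸ : ∀ p q r → q + (r + p) ≡ p + q + r
  pqrʸ = solve-∀
  pqrᶻ : ∀ p q r → r + (q + p) ≡ p + q + r
  pqrᶻ = solve-∀

eigenvalue⇔ : ∀ q β γ → codeEigenvalue 3 q β γ ≡ hammingEigenvalue 3 q 2 ⇔ β + γ ≡ q * 2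
eigenvalue⇔ q β γ = mk⇔
  (λ eq → ℤ.+-injective (ℤ.neg-injective (∙-cancelˡ ℤ.+-0-abelianGroup (ℤ.+ degree 3 q) (ℤ.- ℤ.+ (β + γ)) (ℤ.- ℤ.+ (q * 2)) eq)))
  (cong λ n → ℤ.+ degree 3 q ℤ.- ℤ.+ n)

-- The characterisation

Realisable : ℕ → ℕ → Set
Realisable q γ = Σ (Code 3 q) λ C → Σ ℕ λ β →
  IsCRC1 C β γ × (codeEigenvalue 3 q β γ ≡ hammingEigenvalue 3 q 2) × (γ ≤ β)

regular⇒realisable : ∀ {q γ} .{{_ : NonZero q}} (C : Code 3 q) → 0 < γ → γ ≤ q → Regular C γ → Realisable q γ
regular⇒realisable {q@(suc _)} {γ} C 0<γ γ≤q reg =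
  C , β , regular⇒IsCRC1 C β+γ≡2q (≤-trans 0<γ γ≤β) 0<γ reg , Equivalence.from (eigenvalue⇔ q β γ) β+γ≡2q , γ≤β
  where
  -- The value forced by the eigenvalue; γ ≤ q makes it a true difference and at least γ.
  β = q * 2 ∸ γ
  2γ≤2q : γ + γ ≤ q * 2
  2γ≤2q = ≤-trans (+-mono-≤ γ≤q γ≤q) (≤-reflexive (double q))
  γ≤β : γ ≤ β
  γ≤β = m+n≤o⇒m≤o∸n γ 2γ≤2q
  β+γ≡2q : β + γ ≡ q * 2
  β+γ≡2q = m∸n+n≡m (≤-trans (m≤m+n γ γ) 2γ≤2q)

even⇒realisable : ∀ {q γ} .{{_ : NonZero q}} → 2 ∣ γ → 0 < γ → γ ≤ q → Realisable q γ
even⇒realisable {q} (divides k refl) 0<γ γ≤q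
  with pattern⇒regular (latinPattern q k (≤-trans (≤-trans (m≤m+n k k) (≤-reflexive (double k))) γ≤q))
... | C , reg = regular⇒realisable C 0<γ γ≤q (subst (Regular C) (double k) reg)

condition1⇒regular : ∀ {q γ} → Condition1 q γ → ∃ λ (C : Code 3 q) → Regular C γ
condition1⇒regular cond with condition1⇒pattern cond
... | _ , _ , _ , pat , refl = pattern⇒regular pat

upperHalf⇒realisable : ∀ {p γ} .{{_ : NonZero (p + p)}} → p ≤ γ → γ < p + p → Realisable (p + p) γ
upperHalf⇒realisable {p} {γ} p≤γ γ<q =
  let C , reg = condition1⇒regular (halfCondition1 p b 0<b b≤p)
  in regular⇒realisable (not ∘ C) 0<γ (<⇒≤ γ<q) (regular-not C sum≡ reg)
  where
  -- With b = q - γ the code from Condition 1 has parameter q + b = 2q - γ, so its complement has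
  -- parameter γ.
  b = p + p ∸ γ
  0<b : 0 < b
  0<b = m<n⇒0<n∸m γ<q
  b≤p : b ≤ p
  b≤p = ≤-trans (∸-monoʳ-≤ (p + p) p≤γ) (≤-reflexive (m+n∸n≡m p p))
  0<γ : 0 < γ
  0<γ = ≤-trans (≤-trans 0<b b≤p) p≤γ
  rotate : ∀ γ p b → γ + (p + b + p) ≡ (γ + b) + (p + p)
  rotate = solve-∀
  sum≡ : γ + (p + b + p) ≡ (p + p) * 2
  sum≡ = trans (rotate γ p b) (trans (cong (_+ (p + p)) (m+[n∸m]≡n (<⇒≤ γ<q))) (double (p + p)))

half : ∀ {q} → 2 ∣ q → q / 2 + q / 2 ≡ q
half (divides k refl) = trans (cong₂ _+_ (m*n/n≡m k 2) (m*n/n≡m k 2)) (double k)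

Admissible : ℕ → ℕ → Set
Admissible q γ = (2 ∣ γ × 2 ≤ γ × γ ≤ q)
  ⊎ (2 ∣ q × q / 2 ≤ γ × γ ≤ q)
  ⊎ (2 ∣ q × ¬ (2 ∣ γ) × γ < q / 2 × Condition1 q γ)

odd⇒admissible : ∀ {q γ} (C : Code 3 (suc q)) → Regular C γ → γ ≤ suc q → ¬ 2 ∣ γ → 2 ∣ suc q →
  Admissible (suc q) γ
odd⇒admissible {q} {γ} C reg γ≤q 2∤γ 2∣q = [ below , (λ q/2≤γ → inj₂ (inj₁ (2∣q , q/2≤γ , γ≤q))) ]′ (<-≤-connex γ (suc q / 2))
  where
  below : γ < suc q / 2 → Admissible (suc q) γ
  below γ<q/2 =
    let a , b , c , pat , a+b+c≡γ = regular⇒pattern C reg (subst (γ + γ <_) (half 2∣q) (+-mono-< γ<q/2 γ<q/2))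
    in inj₂ (inj₂ (2∣q , 2∤γ , γ<q/2 ,
         subst (Condition1 (suc q)) a+b+c≡γ (pattern⇒condition1 pat (2∤γ ∘ subst (2 ∣_) a+b+c≡γ))))

regular⇒admissible : ∀ {q γ} (C : Code 3 (suc q)) → 0 < γ → γ ≤ suc q → Regular C γ → Admissible (suc q) γ
regular⇒admissible {q} {γ} C 0<γ γ≤q reg with 2 ∣? γ
... | yes 2∣γ = inj₁ (2∣γ , ∣⇒≤ {{>-nonZero 0<γ}} 2∣γ , γ≤q)
-- Since qγ is even, an odd γ forces q to be even.
... | no  2∤γ = [ odd⇒admissible C reg γ≤q 2∤γ , (λ 2∣γ → contradiction 2∣γ 2∤γ) ]′
                  (euclidsLemma (suc q) γ prime[2] (regular⇒2∣qγ C reg))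

realisable⇒admissible : ∀ {q γ} → Realisable (suc q) γ → Admissible (suc q) γ
realisable⇒admissible {q-1} {γ} (C , β , crc@(_ , _ , 0<γ , _) , eigenvalue , γ≤β) =
  regular⇒admissible C 0<γ γ≤q (IsCRC1⇒regular C β+γ≡2q crc)
  where
  q = suc q-1
  β+γ≡2q : β + γ ≡ q * 2
  β+γ≡2q = Equivalence.to (eigenvalue⇔ q β γ) eigenvalue
  γ≤q : γ ≤ q
  γ≤q = *-cancelʳ-≤ γ q 2 (≤-trans (≤-reflexive (sym (double γ))) (≤-trans (+-monoˡ-≤ γ γ≤β) (≤-reflexive β+γ≡2q)))

admissible⇒realisable : ∀ {q γ} .{{_ : NonZero q}} → Admissible q γ → Realisable q γ
admissible⇒realisable (inj₁ (2∣γ , 2≤γ , γ≤q)) = even⇒realisable 2∣γ (≤-trans (s≤s z≤n) 2≤γ) γ≤q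
admissible⇒realisable {q} {γ} (inj₂ (inj₁ (2∣q , q/2≤γ , γ≤q))) with m≤n⇒m<n∨m≡n γ≤q
-- For γ = q the complement construction would need b = 0, but γ is then even.
... | inj₂ refl = even⇒realisable 2∣q (>-nonZero⁻¹ q) ≤-refl
... | inj₁ γ<q  = upper (half 2∣q) q/2≤γ
  where
  upper : ∀ {p} → p + p ≡ q → p ≤ γ → Realisable q γ
  upper refl p≤γ = upperHalf⇒realisable p≤γ γ<q
admissible⇒realisable {q} (inj₂ (inj₂ (_ , 2∤γ , γ<q/2 , cond))) =
  let C , reg = condition1⇒regular cond
  in regular⇒realisable C (n≢0⇒n>0 λ { refl → 2∤γ (divides 0 refl) }) (≤-trans (<⇒≤ γ<q/2) (m/n≤m q 2)) reg

theorem6 : (q γ : ℕ) → 2 ≤ q →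
    (Σ (Code 3 q) λ C → Σ ℕ λ β →
    IsCRC1 C β γ × (codeEigenvalue 3 q β γ ≡ hammingEigenvalue 3 q 2) × (γ ≤ β))
    ⇔ ((2 ∣ γ × 2 ≤ γ × γ ≤ q)
    ⊎ (2 ∣ q × q / 2 ≤ γ × γ ≤ q)
    ⊎ (2 ∣ q × ¬ (2 ∣ γ) × γ < q / 2 × Condition1 q γ))
theorem6 (suc q) γ 2≤q = mk⇔ realisable⇒admissible admissible⇒realisable
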